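{- Let $f_n=S_n/T_n$ and $v_n=\frac{T_{n-2}T_{n+1}}{T_{n-1}T_n}$. Then, for every integer $n$ such that $f_n,\dots,f_{n+4}$ are finite and the denominators below are nonzero, \[ v_{n+2}^2=\frac{f_{n+1}^2f_{n+2}^3+f_{n+4}}{f_{n+3}(f_n^2-f_{n+2}f_{n+4})}, \qquad v_{n+3}^2=\frac{f_{n+2}^3f_{n+3}^2+f_{n}}{f_{n+1}(f_{n+4}^2-f_{n}f_{n+2})}. \]
   Context: $(S_n)_{n\in\mathbb{Z}}$ is the sequence with $S_{ -2}=S_{ -1}=S_0=S_1=S_2=1$ satisfying $S_{n+5}S_n=S_{n+4}S_{n+1}+S_{n+3}S_{n+2}$ for all $n\in\mathbb{Z}$ (positive integers, $S_{ -n}=S_n$). $(T_n)_{n\in\mathbb{Z}}$ is defined by $T_1=1,T_2=-1,T_3=1,T_4=1,T_5=-7$, $T_{n+5}T_n=T_{n+4}T_{n+1}+T_{n+3}T_{n+2}$ for $n\geq1$, $T_0=0$ and $T_{ -n}=-T_n$ (integers, nonzero for $n\neq0$). The pairs $(v_n,v_{n+1})$ form an orbit of the QRT map $(U,V)\mapsto(V,U^{ -1}(1+V^{ -1}))$. -}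

module Defs where

open import Data.Nat as ℕ using (ℕ; zero; suc)
open import Data.Integer as ℤ using (ℤ; +_; -[1+_]; 0ℤ; -_)
import Data.Integer.DivMod as ℤD
open import Data.Rational as ℚ using (ℚ; 0ℚ)
open import Relation.Nullary using (yes; no)
open import Relation.Binary.PropositionalEquality using (_≡_)

-- Integer division, made total (value 0 when the divisor is 0).
-- It is only ever applied to nonzero divisors in the recurrences below
-- (the sequences S, T are nonzero at the relevant indices), where it is
-- exact division.
_/ℤ_ : ℤ → ℤ → ℤ
a /ℤ d with d ℤ.≟ 0ℤ
... | yes _ = 0ℤ
... | no d≢0 = ℤD._/_ a d {{ℤ.≢-nonZero d≢0}}

-- Rational division, made total (value 0 when the divisor is 0).
-- The statement only uses it with nonzero divisors (hypotheses).
_÷'_ : ℚ → ℚ → ℚ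
p ÷' q with q ℚ.≟ 0ℚ
... | yes _ = 0ℚ
... | no q≢0 = ℚ._÷_ p q {{ℚ.≢-nonZero q≢0}}

-- Sfrom k = S_{k-2} : S_{-2} = ... = S_2 = 1, then the recurrence
-- S_{m+5} S_m = S_{m+4} S_{m+1} + S_{m+3} S_{m+2} run forward from m = -2.
Sfrom : ℕ → ℤ
Sfrom 0 = + 1
Sfrom 1 = + 1
Sfrom 2 = + 1
Sfrom 3 = + 1
Sfrom 4 = + 1
Sfrom (suc (suc (suc (suc (suc k))))) =
  (Sfrom (suc (suc (suc (suc k)))) ℤ.* Sfrom (suc k)
    ℤ.+ Sfrom (suc (suc (suc k))) ℤ.* Sfrom (suc (suc k))) /ℤ Sfrom k

Sℕ : ℕ → ℤ
Sℕ n = Sfrom (suc (suc n))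

S : ℤ → ℤ
S (+ n) = Sℕ n
S -[1+ n ] = Sℕ (suc n)

Tℕ : ℕ → ℤ
Tℕ 0 = 0ℤ
Tℕ 1 = + 1
Tℕ 2 = -[1+ 0 ]
Tℕ 3 = + 1
Tℕ 4 = + 1
Tℕ 5 = -[1+ 6 ]
Tℕ (suc (suc (suc (suc (suc (suc k)))))) =
  (Tℕ (suc (suc (suc (suc (suc k))))) ℤ.* Tℕ (suc (suc k))
    ℤ.+ Tℕ (suc (suc (suc (suc k)))) ℤ.* Tℕ (suc (suc (suc k)))) /ℤ Tℕ (suc k)

T : ℤ → ℤ
T (+ n) = Tℕ n
T -[1+ n ] = - Tℕ (suc n)

toℚ : ℤ → ℚ
toℚ z = z ℚ./ 1

f : ℤ → ℚ
f n = toℚ (S n) ÷' toℚ (T n)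

v : ℤ → ℚ
v n = toℚ (T (n ℤ.- + 2) ℤ.* T (n ℤ.+ + 1)) ÷' toℚ (T (n ℤ.- + 1) ℤ.* T n)

{-# OPTIONS --safe #-}

-- For five consecutive indices write s₀ … s₄ and t₀ … t₄ for the values of S and T.
-- Beside the Somos-5 recurrences the two sequences satisfy the coupled relations
--   t₀t₃ = s₁s₂ + t₁t₂,   s₀s₃ = s₁s₂ − t₁t₂,
--   t₂²t₃ = s₁s₂t₄ + s₃s₄t₀,   s₂²s₃ + t₁t₂s₄ + t₃t₄s₀ = 0,
-- which propagate from one window to the next.  They also give
--   t₂(t₄t₁ + t₃t₂) = t₀(s₃s₄ + t₃t₄),   s₂(s₄s₁ + s₃s₂) = s₀(s₃s₄ − t₃t₄),
-- so coprimality of neighbouring terms makes the divisions in the recurrences exact.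
-- If t₅ were 0, coprimality would make t₃ and t₄ units, and s₃s₄ = t₂t₅ − t₃t₄ would
-- be ±1, whereas S exceeds 1 from S₃ on; hence T never vanishes.  With denominators
-- cleared, the first formula is a linear combination of the relations above, and the
-- second one is the first for the reversed window.
module Submission where

open import Defs
open import Data.Integer using (ℤ; +_; 0ℤ) renaming (_+_ to _+ℤ_)
open import Relation.Binary.PropositionalEquality using (_≡_; _≢_)
open import Data.Product using (_×_)

import Algebra.Properties.AbelianGroup as AbelianGroup
open import Data.Integer using (-[1+_]; 1ℤ)
import Data.Integer as ℤ
import Data.Integer.DivMod as ℤ
import Data.Integer.Properties as ℤ
open import Data.List using ([]; _∷_)
open import Data.Maybe using (nothing)
open import Data.Nat using (zero; suc)
import Data.Nat as ℕ
import Data.Nat.Coprimality as ℕ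
import Data.Nat.Properties as ℕ
open import Data.Product using (_,_; ∃; ∃₂)
import Data.Rational.Properties as ℚ
open import Level using (0ℓ)
open import Relation.Binary.PropositionalEquality using (refl; sym; trans; cong; cong₂; subst; module ≡-Reasoning)
open import Relation.Nullary using (yes; no; contradiction)
import Tactic.RingSolver as RingSolver
open import Tactic.RingSolver.Core.AlmostCommutativeRing using (AlmostCommutativeRing; fromCommutativeRing)

module Integers where

  open import Data.Integer using (_+_; _*_; _-_; -_; ∣_∣; _≤_; _<_; +<+; +≤+; ≢-nonZero)
  open import Data.Integer.Tactic.RingSolver using (solve; solve-∀)
  open AbelianGroup ℤ.+-0-abelianGroup using () renaming (∙-cancelʳ to +-cancelʳ)

  -- Linear combinations of equations and exact division in ℤ.

  infixl 6 _⊕_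
  infixr 7 _⊛_

  _⊕_ : ∀ {a b c d} → a ≡ b → c ≡ d → a + c ≡ b + d
  _⊕_ = cong₂ _+_

  _⊛_ : ∀ k {a b} → a ≡ b → k * a ≡ k * b
  k ⊛ p = cong (k *_) p

  -- Reduces x ≡ y to the ring identity x − y = l − r, written without subtraction.
  from-combination : ∀ {l r x y} → l ≡ r → x + r ≡ y + l → x ≡ y
  from-combination {l} refl x+l≡y+l = +-cancelʳ l _ _ x+l≡y+l

  *-cancelˡ : ∀ {a x y} → a ≢ 0ℤ → a * x ≡ a * y → x ≡ y
  *-cancelˡ {a} a≢0 = ℤ.*-cancelˡ-≡ a _ _ {{≢-nonZero a≢0}}

  *-≢0 : ∀ {a b} → a ≢ 0ℤ → b ≢ 0ℤ → a * b ≢ 0ℤ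
  *-≢0 {a} a≢0 b≢0 ab≡0 = b≢0 (*-cancelˡ a≢0 (trans ab≡0 (sym (ℤ.*-zeroʳ a))))

  [q-p]d≡r : ∀ {a d} p q r → a ≡ q * d → a ≡ r + p * d → (q - p) * d ≡ r
  [q-p]d≡r {a} {d} p q r a≡qd a≡r+pd =
    from-combination (sym a≡qd ⊕ a≡r+pd) (solve (a ∷ d ∷ p ∷ r ∷ q ∷ []))

  -- The remainder equals `(q - p) * d` and is smaller than `d` in absolute value, which forces
  -- `q - p` to be 0.
  /ℤ-exact : ∀ {a d q} → d ≢ 0ℤ → a ≡ q * d → a /ℤ d ≡ q
  /ℤ-exact {a} {d} {q} d≢0 a≡qd with d ℤ.≟ 0ℤ
  ... | yes d≡0 = contradiction d≡0 d≢0
  ... | no d≢0′ = sym (ℤ.i-j≡0⇒i≡j q p (ℤ.∣i∣≡0⇒i≡0 (m*n<n⇒m≡0 _ ∣q-p∣*∣d∣<∣d∣)))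
    where
    instance d-nonZero = ≢-nonZero d≢0′
    p = a ℤ./ d

    ∣q-p∣*∣d∣<∣d∣ : ∣ q - p ∣ ℕ.* ∣ d ∣ ℕ.< ∣ d ∣
    ∣q-p∣*∣d∣<∣d∣ = subst (ℕ._< ∣ d ∣)
      (trans (sym (cong ∣_∣ ([q-p]d≡r p q (+ (a ℤ.% d)) a≡qd (ℤ.a≡a%n+[a/n]*n a d)))) (ℤ.∣i*j∣≡∣i∣*∣j∣ (q - p) d))
      (ℤ.n%d<d a d)

    m*n<n⇒m≡0 : ∀ {n} m → m ℕ.* n ℕ.< n → m ≡ 0
    m*n<n⇒m≡0 zero        _     = refl
    m*n<n⇒m≡0 {n} (suc m) mn<n = contradiction mn<n (ℕ.m+n≮m n (m ℕ.* n))

  k*a≢1 : ∀ {a} k → 1ℤ < a → k * a ≢ 1ℤ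
  k*a≢1 {+ n} k (+<+ 1<n) ka≡1 = ℕ.<⇒≢ 1<n (sym (ℕ.m*n≡1⇒n≡1 ∣ k ∣ n
    (trans (sym (ℤ.∣i*j∣≡∣i∣*∣j∣ k (+ n))) (cong ∣_∣ ka≡1))))

  -- Coprimality as a Bézout identity, so that ring identities transport it.

  Coprime : ℤ → ℤ → Set
  Coprime a b = ∃₂ λ u v → u * a + v * b ≡ 1ℤ

  coprime-sym : ∀ {a b} → Coprime a b → Coprime b a
  coprime-sym {a} {b} (u , v , e) = v , u , trans (ℤ.+-comm (v * b) (u * a)) e

  coprime-* : ∀ {a b c} → Coprime a b → Coprime a c → Coprime a (b * c)
  coprime-* {a} {b} {c} (u , v , e) (u′ , v′ , e′) =
    u * u′ * a + u * (v′ * c) + u′ * (v * b) , v * v′ ,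
    trans (identity u a v b u′ v′ c) (cong₂ _*_ e e′)
    where
    identity : ∀ u a v b u′ v′ c →
      (u * u′ * a + u * (v′ * c) + u′ * (v * b)) * a + v * v′ * (b * c)
      ≡ (u * a + v * b) * (u′ * a + v′ * c)
    identity = solve-∀

  -- Replace `b` by `c * q - a * k` in the Bézout identity. In use, `c` is the new Somos term and
  -- `q` the term divided by.
  coprime-factor : ∀ {a b c k q} → c * q ≡ a * k + b → Coprime a b → Coprime a c
  coprime-factor {a} {b} {c} {k} {q} cq≡ak+b (u , v , e) = u - v * k , v * q ,
    from-combination (v ⊛ cq≡ak+b ⊕ e) (solve (a ∷ b ∷ c ∷ k ∷ q ∷ u ∷ v ∷ []))

  -- The Bézout combination `u * x + v * y` meets both demands at once. Applied to the numerators
  -- below, it gives the next term of a sequence together with its coupled relation.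
  coprime-divides : ∀ {a b x y} → Coprime a b → b * x ≡ a * y →
    ∃ λ q → x ≡ q * a × b * q ≡ y
  coprime-divides {a} {b} {x} {y} (u , v , e) bx≡ay = u * x + v * y ,
    from-combination ((- x) ⊛ e ⊕ v ⊛ bx≡ay) (solve (a ∷ b ∷ x ∷ y ∷ u ∷ v ∷ [])) ,
    from-combination (y ⊛ e ⊕ u ⊛ bx≡ay) (solve (a ∷ b ∷ x ∷ y ∷ u ∷ v ∷ []))

  -- Coprimality at distances 1 and 2 is closed under the recurrence: the new term is prime to `a₄`
  -- because `a₃ * a₂` is, and to `a₃` because `a₄ * a₁` is.
  record CoprimeRun (a₀ a₁ a₂ a₃ a₄ : ℤ) : Set where
    field
      c₀₁ : Coprime a₀ a₁
      c₁₂ : Coprime a₁ a₂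
      c₂₃ : Coprime a₂ a₃
      c₃₄ : Coprime a₃ a₄
      c₀₂ : Coprime a₀ a₂
      c₁₃ : Coprime a₁ a₃
      c₂₄ : Coprime a₂ a₄

  coprimeRun-step : ∀ {a₀ a₁ a₂ a₃ a₄ a₅} → CoprimeRun a₀ a₁ a₂ a₃ a₄ →
    a₄ * a₁ + a₃ * a₂ ≡ a₅ * a₀ → CoprimeRun a₁ a₂ a₃ a₄ a₅
  coprimeRun-step {a₀} {a₁} {a₂} {a₃} {a₄} {a₅} run somos = record
    { c₀₁ = c₁₂
    ; c₁₂ = c₂₃
    ; c₂₃ = c₃₄
    ; c₃₄ = coprime-factor (sym somos) (coprime-* (coprime-sym c₃₄) (coprime-sym c₂₄))
    ; c₀₂ = c₁₃
    ; c₁₃ = c₂₄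
    ; c₂₄ = coprime-factor (trans (sym somos) (ℤ.+-comm (a₄ * a₁) (a₃ * a₂)))
              (coprime-* c₃₄ (coprime-sym c₁₃))
    }
    where open CoprimeRun run

  -- Coupled relations between S and T on five consecutive indices.

  record Window (s₀ s₁ s₂ s₃ s₄ t₀ t₁ t₂ t₃ t₄ : ℤ) : Set where
    field
      t₀t₃ : t₀ * t₃ ≡ s₁ * s₂ + t₁ * t₂
      t₁t₄ : t₁ * t₄ ≡ s₂ * s₃ + t₂ * t₃
      s₀s₃ : s₀ * s₃ ≡ s₁ * s₂ - t₁ * t₂
      s₁s₄ : s₁ * s₄ ≡ s₂ * s₃ - t₂ * t₃
      t₂t₂t₃ : t₂ * t₂ * t₃ ≡ s₁ * s₂ * t₄ + s₃ * s₄ * t₀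
      s₂s₂s₃ : s₂ * s₂ * s₃ + t₁ * t₂ * s₄ + t₃ * t₄ * s₀ ≡ 0ℤ

  module _ {s₀ s₁ s₂ s₃ s₄ t₀ t₁ t₂ t₃ t₄ : ℤ} (w : Window s₀ s₁ s₂ s₃ s₄ t₀ t₁ t₂ t₃ t₄) where
    open Window w

    -- The cubic relation turns the left side into `s₄ * (s₁ * s₂ - t₁ * t₂) - s₀ * t₃ * t₄`, and
    -- `s₀s₃` exposes the factor `s₀`.
    s-numerator : s₂ * (s₄ * s₁ + s₃ * s₂) ≡ s₀ * (s₃ * s₄ - t₃ * t₄)
    s-numerator = from-combination (s₂s₂s₃ ⊕ (- s₄) ⊛ s₀s₃)
      (solve (s₀ ∷ s₁ ∷ s₂ ∷ s₃ ∷ s₄ ∷ t₁ ∷ t₂ ∷ t₃ ∷ t₄ ∷ []))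

    t-numerator : t₂ * (t₄ * t₁ + t₃ * t₂) ≡ t₀ * (s₃ * s₄ + t₃ * t₄)
    t-numerator = from-combination (t₂t₂t₃ ⊕ (- t₄) ⊛ t₀t₃)
      (solve (s₁ ∷ s₂ ∷ s₃ ∷ s₄ ∷ t₀ ∷ t₁ ∷ t₂ ∷ t₃ ∷ t₄ ∷ []))

    -- The factor `s₂ * t₂` allows `s₅` and `t₅` to be eliminated. The two cubic relations then
    -- exchange roles: each new one follows from the old one of the other kind.
    window-step : ∀ {s₅ t₅} → s₂ ≢ 0ℤ → t₂ ≢ 0ℤ →
      s₂ * s₅ ≡ s₃ * s₄ - t₃ * t₄ → t₂ * t₅ ≡ s₃ * s₄ + t₃ * t₄ →
      Window s₁ s₂ s₃ s₄ s₅ t₁ t₂ t₃ t₄ t₅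
    window-step {s₅} {t₅} s₂≢0 t₂≢0 s₂s₅ t₂t₅ = record
      { t₀t₃ = t₁t₄
      ; t₁t₄ = t₂t₅
      ; s₀s₃ = s₁s₄
      ; s₁s₄ = s₂s₅
      ; t₂t₂t₃ = *-cancelˡ (*-≢0 s₂≢0 t₂≢0) (from-combination
          ((- (s₂ * s₂ * s₃)) ⊛ t₂t₅ ⊕ (- (t₁ * t₂ * s₄)) ⊛ s₂s₅ ⊕ (- (s₃ * s₄)) ⊛ s₂s₂s₃
            ⊕ (t₃ * t₄ * s₄) ⊛ s₀s₃ ⊕ (t₃ * t₄ * s₂) ⊛ s₁s₄)
          (solve (s₀ ∷ s₁ ∷ s₂ ∷ s₃ ∷ s₄ ∷ s₅ ∷ t₀ ∷ t₁ ∷ t₂ ∷ t₃ ∷ t₄ ∷ t₅ ∷ [])))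
      ; s₂s₂s₃ = *-cancelˡ (*-≢0 s₂≢0 t₂≢0) (from-combination
          ((t₂ * t₂ * t₃) ⊛ s₂s₅ ⊕ (t₄ * s₁ * s₂) ⊛ t₂t₅ ⊕ (- (t₃ * t₄)) ⊛ t₂t₂t₃
            ⊕ (- (s₃ * s₄ * t₂)) ⊛ t₁t₄ ⊕ (- (s₃ * s₄ * t₄)) ⊛ t₀t₃)
          (solve (s₀ ∷ s₁ ∷ s₂ ∷ s₃ ∷ s₄ ∷ s₅ ∷ t₀ ∷ t₁ ∷ t₂ ∷ t₃ ∷ t₄ ∷ t₅ ∷ [])))
      }

    -- The quadratic relations are permuted. Modulo them, `s₁` times the old cubic relation for t is
    -- `s₃` times its mirror image, and `t₁` times the one for s is `t₃` times its mirror image.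
    window-reverse : s₃ ≢ 0ℤ → t₃ ≢ 0ℤ → Window s₄ s₃ s₂ s₁ s₀ t₄ t₃ t₂ t₁ t₀
    window-reverse s₃≢0 t₃≢0 = record
      { t₀t₃ = from-combination t₁t₄ (solve (s₂ ∷ s₃ ∷ t₁ ∷ t₂ ∷ t₃ ∷ t₄ ∷ []))
      ; t₁t₄ = from-combination t₀t₃ (solve (s₁ ∷ s₂ ∷ t₀ ∷ t₁ ∷ t₂ ∷ t₃ ∷ []))
      ; s₀s₃ = from-combination s₁s₄ (solve (s₁ ∷ s₂ ∷ s₃ ∷ s₄ ∷ t₂ ∷ t₃ ∷ []))
      ; s₁s₄ = from-combination s₀s₃ (solve (s₀ ∷ s₁ ∷ s₂ ∷ s₃ ∷ t₁ ∷ t₂ ∷ []))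
      ; t₂t₂t₃ = *-cancelˡ s₃≢0 (from-combination
          (s₁ ⊛ t₂t₂t₃ ⊕ (- (s₁ * t₄)) ⊛ s₀s₃ ⊕ (s₃ * t₀) ⊛ s₁s₄
            ⊕ (t₂ * s₁) ⊛ t₁t₄ ⊕ (- (t₂ * s₃)) ⊛ t₀t₃)
          (solve (s₀ ∷ s₁ ∷ s₂ ∷ s₃ ∷ s₄ ∷ t₀ ∷ t₁ ∷ t₂ ∷ t₃ ∷ t₄ ∷ [])))
      ; s₂s₂s₃ = *-cancelˡ t₃≢0 (from-combination
          (t₁ ⊛ s₂s₂s₃ ⊕ (- (s₀ * t₃)) ⊛ t₁t₄ ⊕ (t₁ * s₄) ⊛ t₀t₃
            ⊕ (- (s₂ * t₃)) ⊛ s₀s₃ ⊕ (t₁ * s₂) ⊛ s₁s₄)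
          (solve (s₀ ∷ s₁ ∷ s₂ ∷ s₃ ∷ s₄ ∷ t₀ ∷ t₁ ∷ t₂ ∷ t₃ ∷ t₄ ∷ [])))
      }

    -- Every relation is even or odd in the t's. Combined with reversal, this reaches negative
    -- indices, since S is even and T odd.
    window-negate : Window s₀ s₁ s₂ s₃ s₄ (- t₀) (- t₁) (- t₂) (- t₃) (- t₄)
    window-negate = record
      { t₀t₃ = from-combination t₀t₃ (solve (s₁ ∷ s₂ ∷ t₀ ∷ t₁ ∷ t₂ ∷ t₃ ∷ []))
      ; t₁t₄ = from-combination t₁t₄ (solve (s₂ ∷ s₃ ∷ t₁ ∷ t₂ ∷ t₃ ∷ t₄ ∷ []))
      ; s₀s₃ = from-combination s₀s₃ (solve (s₀ ∷ s₁ ∷ s₂ ∷ s₃ ∷ t₁ ∷ t₂ ∷ []))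
      ; s₁s₄ = from-combination s₁s₄ (solve (s₁ ∷ s₂ ∷ s₃ ∷ s₄ ∷ t₂ ∷ t₃ ∷ []))
      ; t₂t₂t₃ = from-combination ((- 1ℤ) ⊛ t₂t₂t₃)
          (solve (s₁ ∷ s₂ ∷ s₃ ∷ s₄ ∷ t₀ ∷ t₂ ∷ t₃ ∷ t₄ ∷ []))
      ; s₂s₂s₃ = from-combination s₂s₂s₃
          (solve (s₀ ∷ s₂ ∷ s₃ ∷ s₄ ∷ t₁ ∷ t₂ ∷ t₃ ∷ t₄ ∷ []))
      }

    -- The first formula with `fᵢ = sᵢ / tᵢ` and `v = t₀t₃ / (t₁t₂)`, multiplied by `t₁²t₂³t₄`.
    window-formula :
      t₃ * s₃ * (t₂ * t₄ * (s₀ * s₀) - s₂ * s₄ * (t₀ * t₀))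
      ≡ s₁ * s₁ * (s₂ * s₂ * s₂) * t₄ + s₄ * (t₁ * t₁) * (t₂ * t₂ * t₂)
    window-formula = from-combination
      -- On the left, rewrite `s₀s₃` and `s₃s₄t₀`, then `t₀t₃` and `t₃t₄s₀`; the surplus over the
      -- right side vanishes by `t₁t₄` and `s₁s₄`.
      ((t₂ * t₃ * t₄ * s₀) ⊛ s₀s₃ ⊕ (t₀ * t₃ * s₂) ⊛ t₂t₂t₃
        ⊕ (- (s₂ * (t₂ * t₂ * t₃ - s₁ * s₂ * t₄))) ⊛ t₀t₃
        ⊕ (t₂ * (s₁ * s₂ - t₁ * t₂)) ⊛ s₂s₂s₃
        ⊕ (s₂ * t₂ * (s₁ * s₂)) ⊛ t₁t₄ ⊕ (- (s₂ * t₂ * (t₁ * t₂))) ⊛ s₁s₄)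
      (solve (s₀ ∷ s₁ ∷ s₂ ∷ s₃ ∷ s₄ ∷ t₀ ∷ t₁ ∷ t₂ ∷ t₃ ∷ t₄ ∷ []))

  -- If `t₅` were 0, then `v * (t₃ * t₄)` would be 1 and `t₃ * t₄` would be `- (s₃ * s₄)`, so `s₄`
  -- would divide 1.
  t-next-≢0 : ∀ {s₄ t₅} s₃ t₂ t₃ t₄ → 1ℤ < s₄ →
    t₂ * t₅ ≡ s₃ * s₄ + t₃ * t₄ → Coprime t₅ (t₃ * t₄) → t₅ ≢ 0ℤ
  t-next-≢0 {s₄} s₃ t₂ t₃ t₄ 1<s₄ t₂t₅ (u , v , e) refl =
    k*a≢1 (- (v * s₃)) 1<s₄ (from-combination (v ⊛ t₂t₅ ⊕ e)
      (solve (s₃ ∷ s₄ ∷ t₂ ∷ t₃ ∷ t₄ ∷ u ∷ v ∷ [])))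

  -- Induction along the positive indices.

  record State (s₀ s₁ s₂ s₃ s₄ t₀ t₁ t₂ t₃ t₄ : ℤ) : Set where
    field
      window : Window s₀ s₁ s₂ s₃ s₄ t₀ t₁ t₂ t₃ t₄
      s-coprime : CoprimeRun s₀ s₁ s₂ s₃ s₄
      t-coprime : CoprimeRun t₀ t₁ t₂ t₃ t₄
      0<s₀ : 0ℤ < s₀
      -- Monotonicity keeps the last s above 1, which in turn keeps the next t nonzero.
      s₀≤s₁ : s₀ ≤ s₁
      s₁≤s₂ : s₁ ≤ s₂
      s₂≤s₃ : s₂ ≤ s₃
      s₃≤s₄ : s₃ ≤ s₄
      1<s₄ : 1ℤ < s₄
      t₀≢0 : t₀ ≢ 0ℤ
      t₁≢0 : t₁ ≢ 0ℤ
      t₂≢0 : t₂ ≢ 0ℤ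
      t₃≢0 : t₃ ≢ 0ℤ
      t₄≢0 : t₄ ≢ 0ℤ

    0<s₁ : 0ℤ < s₁
    0<s₁ = ℤ.<-≤-trans 0<s₀ s₀≤s₁

    0<s₂ : 0ℤ < s₂
    0<s₂ = ℤ.<-≤-trans 0<s₁ s₁≤s₂

    0<s₃ : 0ℤ < s₃
    0<s₃ = ℤ.<-≤-trans 0<s₂ s₂≤s₃

    0<s₄ : 0ℤ < s₄
    0<s₄ = ℤ.<-≤-trans 0<s₃ s₃≤s₄

  >⇒≢0 : ∀ {a} → 0ℤ < a → a ≢ 0ℤ
  >⇒≢0 0<a a≡0 = ℤ.<⇒≢ 0<a (sym a≡0)

  state-step : ∀ {s₀ s₁ s₂ s₃ s₄ t₀ t₁ t₂ t₃ t₄} → State s₀ s₁ s₂ s₃ s₄ t₀ t₁ t₂ t₃ t₄ →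
    State s₁ s₂ s₃ s₄ ((s₄ * s₁ + s₃ * s₂) /ℤ s₀) t₁ t₂ t₃ t₄ ((t₄ * t₁ + t₃ * t₂) /ℤ t₀)
  state-step {s₀} {s₁} {s₂} {s₃} {s₄} {t₀} {t₁} {t₂} {t₃} {t₄} state
    with coprime-divides (CoprimeRun.c₀₂ (State.s-coprime state)) (s-numerator (State.window state))
       | coprime-divides (CoprimeRun.c₀₂ (State.t-coprime state)) (t-numerator (State.window state))
  ... | s₅ , s-somos , s₂s₅ | t₅ , t-somos , t₂t₅
    -- The exact quotients found by coprimality are identified with the values of the total division
    -- in the recurrences.
    rewrite /ℤ-exact (>⇒≢0 (State.0<s₀ state)) s-somos | /ℤ-exact (State.t₀≢0 state) t-somos = record
      { window = window-step window (>⇒≢0 0<s₂) t₂≢0 s₂s₅ t₂t₅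
      ; s-coprime = coprimeRun-step s-coprime s-somos
      ; t-coprime = t-coprime′
      ; 0<s₀ = 0<s₁
      ; s₀≤s₁ = s₁≤s₂
      ; s₁≤s₂ = s₂≤s₃
      ; s₂≤s₃ = s₃≤s₄
      ; s₃≤s₄ = s₄≤s₅
      ; 1<s₄ = ℤ.<-≤-trans 1<s₄ s₄≤s₅
      ; t₀≢0 = t₁≢0
      ; t₁≢0 = t₂≢0
      ; t₂≢0 = t₃≢0
      ; t₃≢0 = t₄≢0
      ; t₄≢0 = t-next-≢0 s₃ t₂ t₃ t₄ 1<s₄ t₂t₅ (coprime-* (coprime-sym c₂₄) (coprime-sym c₃₄))
      }
    where
    open State state
    t-coprime′ = coprimeRun-step t-coprime t-somos
    open CoprimeRun t-coprime′ using (c₂₄; c₃₄)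

    s₄≤s₅ : s₄ ≤ s₅
    s₄≤s₅ = ℤ.*-cancelʳ-≤-pos s₄ s₅ s₀ {{ℤ.positive 0<s₀}} (begin
      s₄ * s₀            ≤⟨ ℤ.*-monoˡ-≤-nonNeg s₄ {{ℤ.nonNegative (ℤ.<⇒≤ 0<s₄)}} s₀≤s₁ ⟩
      s₄ * s₁            ≡⟨ ℤ.+-identityʳ (s₄ * s₁) ⟨
      s₄ * s₁ + 0ℤ       ≡⟨ cong (_+_ (s₄ * s₁)) (ℤ.*-zeroʳ s₃) ⟨
      s₄ * s₁ + s₃ * 0ℤ  ≤⟨ ℤ.+-monoʳ-≤ (s₄ * s₁) (ℤ.*-monoˡ-≤-nonNeg s₃ {{ℤ.nonNegative (ℤ.<⇒≤ 0<s₃)}} (ℤ.<⇒≤ 0<s₂)) ⟩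
      s₄ * s₁ + s₃ * s₂  ≡⟨ s-somos ⟩
      s₅ * s₀            ∎)
      where open ℤ.≤-Reasoning

  -- `Sfrom` is shifted by 2, so both rows cover the indices k+1 to k+5. The start at 1 avoids the
  -- zero of T at 0.
  state : ∀ k → State
    (Sfrom (3 ℕ.+ k)) (Sfrom (4 ℕ.+ k)) (Sfrom (5 ℕ.+ k)) (Sfrom (6 ℕ.+ k)) (Sfrom (7 ℕ.+ k))
    (Tℕ (1 ℕ.+ k)) (Tℕ (2 ℕ.+ k)) (Tℕ (3 ℕ.+ k)) (Tℕ (4 ℕ.+ k)) (Tℕ (5 ℕ.+ k))
  state (suc k) = state-step (state k)
  state zero = record
    { window = record
        { t₀t₃ = refl ; t₁t₄ = refl ; s₀s₃ = refl ; s₁s₄ = refl ; t₂t₂t₃ = refl ; s₂s₂s₃ = refl }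
    ; s-coprime = record
        { c₀₁ = + 1 , + 0 , refl
        ; c₁₂ = + 1 , + 0 , refl
        ; c₂₃ = -[1+ 0 ] , + 1 , refl
        ; c₃₄ = + 2 , -[1+ 0 ] , refl
        ; c₀₂ = + 1 , + 0 , refl
        ; c₁₃ = + 1 , + 0 , refl
        ; c₂₄ = -[1+ 1 ] , + 1 , refl
        }
    ; t-coprime = record
        { c₀₁ = + 1 , + 0 , refl
        ; c₁₂ = + 0 , + 1 , refl
        ; c₂₃ = + 1 , + 0 , refl
        ; c₃₄ = + 1 , + 0 , refl
        ; c₀₂ = + 1 , + 0 , refl
        ; c₁₃ = + 0 , + 1 , refl
        ; c₂₄ = + 1 , + 0 , refl
        }
    ; 0<s₀ = +<+ (ℕ.s≤s ℕ.z≤n)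
    ; s₀≤s₁ = ℤ.≤-refl
    ; s₁≤s₂ = +≤+ (ℕ.s≤s ℕ.z≤n)
    ; s₂≤s₃ = +≤+ (ℕ.s≤s (ℕ.s≤s ℕ.z≤n))
    ; s₃≤s₄ = +≤+ (ℕ.s≤s (ℕ.s≤s (ℕ.s≤s ℕ.z≤n)))
    ; 1<s₄ = +<+ (ℕ.s≤s (ℕ.s≤s ℕ.z≤n))
    ; t₀≢0 = λ ()
    ; t₁≢0 = λ ()
    ; t₂≢0 = λ ()
    ; t₃≢0 = λ ()
    ; t₄≢0 = λ ()
    }

  -- Windows at arbitrary integer indices, in both directions.

  windows : ∀ n → T n ≢ 0ℤ → T (n + + 1) ≢ 0ℤ → T (n + + 2) ≢ 0ℤ → T (n + + 3) ≢ 0ℤ → T (n + + 4) ≢ 0ℤ →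
    Window (S n) (S (n + + 1)) (S (n + + 2)) (S (n + + 3)) (S (n + + 4))
           (T n) (T (n + + 1)) (T (n + + 2)) (T (n + + 3)) (T (n + + 4))
    × Window (S (n + + 4)) (S (n + + 3)) (S (n + + 2)) (S (n + + 1)) (S n)
             (T (n + + 4)) (T (n + + 3)) (T (n + + 2)) (T (n + + 1)) (T n)
  -- A window that contains index 0 contradicts a hypothesis; any other is wholly positive or wholly
  -- negative.
  windows (+ zero) t₀≢0 _ _ _ _ = contradiction refl t₀≢0
  windows (+ suc k) _ _ _ _ _
    rewrite ℕ.+-comm k 1 | ℕ.+-comm k 2 | ℕ.+-comm k 3 | ℕ.+-comm k 4 =
      window , window-reverse window (>⇒≢0 0<s₃) t₃≢0
    where open State (state k)
  windows -[1+ 0 ] _ t₁≢0 _ _ _ = contradiction refl t₁≢0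
  windows -[1+ 1 ] _ _ t₂≢0 _ _ = contradiction refl t₂≢0
  windows -[1+ 2 ] _ _ _ t₃≢0 _ = contradiction refl t₃≢0
  windows -[1+ 3 ] _ _ _ _ t₄≢0 = contradiction refl t₄≢0
  -- Here n is -(k+5), so the indices are those of `state k` negated and in reverse order.
  windows -[1+ suc (suc (suc (suc k))) ] _ _ _ _ _ =
      window-negate (window-reverse window (>⇒≢0 0<s₃) t₃≢0) , window-negate window
    where open State (state k)

  v-factors : ∀ n → v (n + + 2) ≡ toℚ (T n * T (n + + 3)) ÷' toℚ (T (n + + 1) * T (n + + 2))
  v-factors n = cong₂ _÷'_
    (cong₂ (λ i j → toℚ (T i * T j)) (trans (ℤ.+-assoc n (+ 2) (- + 2)) (ℤ.+-identityʳ n)) (ℤ.+-assoc n (+ 2) (+ 1)))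
    (cong (λ i → toℚ (T i * T (n + + 2))) (ℤ.+-assoc n (+ 2) (- + 1)))

  -- The factors are ordered as the quotient `t₀t₃ / (t₁t₂)` of the reversed window.
  v-factors-reversed : ∀ n →
    v (n + + 3) ≡ toℚ (T (n + + 4) * T (n + + 1)) ÷' toℚ (T (n + + 3) * T (n + + 2))
  v-factors-reversed n = cong₂ (λ x y → toℚ x ÷' toℚ y)
    (trans (cong₂ (λ i j → T i * T j) (ℤ.+-assoc n (+ 3) (- + 2)) (ℤ.+-assoc n (+ 3) (+ 1))) (ℤ.*-comm (T (n + + 1)) (T (n + + 4))))
    (trans (cong (λ i → T i * T (n + + 3)) (ℤ.+-assoc n (+ 3) (- + 1))) (ℤ.*-comm (T (n + + 2)) (T (n + + 3))))

open Integers using (Window; window-formula; windows; v-factors; v-factors-reversed)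
open import Data.Rational using (ℚ; 0ℚ; _+_; _-_; _*_)
import Data.Rational as ℚ

-- Division in ℚ and the embedding of ℤ.

÷'-*-cancel : ∀ {p q} → q ≢ 0ℚ → (p ÷' q) * q ≡ p
÷'-*-cancel {p} {q} q≢0 with q ℚ.≟ 0ℚ
... | yes q≡0 = contradiction q≡0 q≢0
... | no q≢0′ = trans (ℚ.*-assoc p (ℚ.1/ q) q) (trans (cong (p *_) (ℚ.*-inverseˡ q)) (ℚ.*-identityʳ p))
  where instance q-nonZero = ℚ.≢-nonZero q≢0′

*-cancelˡ : ∀ {a x y} → a ≢ 0ℚ → a * x ≡ a * y → x ≡ y
*-cancelˡ {a} {x} {y} a≢0 ax≡ay = begin
  x                ≡⟨ ℚ.*-identityˡ x ⟨
  ℚ.1ℚ * x         ≡⟨ cong (_* x) (ℚ.*-inverseˡ a) ⟨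
  ℚ.1/ a * a * x   ≡⟨ ℚ.*-assoc (ℚ.1/ a) a x ⟩
  ℚ.1/ a * (a * x) ≡⟨ cong (ℚ.1/ a *_) ax≡ay ⟩
  ℚ.1/ a * (a * y) ≡⟨ ℚ.*-assoc (ℚ.1/ a) a y ⟨
  ℚ.1/ a * a * y   ≡⟨ cong (_* y) (ℚ.*-inverseˡ a) ⟩
  ℚ.1ℚ * y         ≡⟨ ℚ.*-identityˡ y ⟩
  y                ∎
  where
  open ≡-Reasoning
  instance a-nonZero = ℚ.≢-nonZero a≢0

*-≢0 : ∀ {a b} → a ≢ 0ℚ → b ≢ 0ℚ → a * b ≢ 0ℚ
*-≢0 {a} a≢0 b≢0 ab≡0 = b≢0 (*-cancelˡ a≢0 (trans ab≡0 (sym (ℚ.*-zeroʳ a))))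

÷'-unique : ∀ {x p q} → q ≢ 0ℚ → x * q ≡ p → x ≡ p ÷' q
÷'-unique {x} {p} {q} q≢0 xq≡p = *-cancelˡ q≢0 (begin
  q * x          ≡⟨ ℚ.*-comm q x ⟩
  x * q          ≡⟨ xq≡p ⟩
  p              ≡⟨ ÷'-*-cancel q≢0 ⟨
  (p ÷' q) * q   ≡⟨ ℚ.*-comm (p ÷' q) q ⟩
  q * (p ÷' q)   ∎)
  where open ≡-Reasoning

-- `toℚ` normalises by a gcd and is stuck on a variable; with an explicit denominator 1, sums and
-- products compute.
toℚ≡mkℚ : ∀ z → toℚ z ≡ ℚ.mkℚ z 0 (ℕ.sym (ℕ.1-coprimeTo ℤ.∣ z ∣))
toℚ≡mkℚ z = ℚ.↥p/↧p≡p (ℚ.mkℚ z 0 _)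

toℚ-≢0 : ∀ {z} → z ≢ 0ℤ → toℚ z ≢ 0ℚ
toℚ-≢0 {z} z≢0 z/1≡0 = z≢0 (cong ℚ.numerator (trans (sym (toℚ≡mkℚ z)) z/1≡0))

-- A record rather than the bare equation, so that z and x can be inferred.
infix 4 _↦_
record _↦_ (z : ℤ) (x : ℚ) : Set where
  constructor mk↦
  field image : toℚ z ≡ x

open _↦_

infixl 6 _+↦_ _-↦_
infixl 7 _*↦_

_*↦_ : ∀ {a b x y} → a ↦ x → b ↦ y → a ℤ.* b ↦ x * y
_*↦_ {a} {b} (mk↦ refl) (mk↦ refl) = mk↦ (sym (cong₂ _*_ (toℚ≡mkℚ a) (toℚ≡mkℚ b)))

_+↦_ : ∀ {a b x y} → a ↦ x → b ↦ y → a ℤ.+ b ↦ x + y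
_+↦_ {a} {b} (mk↦ refl) (mk↦ refl) = mk↦ (sym (trans (cong₂ _+_ (toℚ≡mkℚ a) (toℚ≡mkℚ b))
  (cong toℚ (cong₂ ℤ._+_ (ℤ.*-identityʳ a) (ℤ.*-identityʳ b)))))

toℚ-neg : ∀ a → toℚ (ℤ.- a) ≡ ℚ.- toℚ a
toℚ-neg (+ zero)  = refl
toℚ-neg (+ suc n) = refl
toℚ-neg -[1+ n ]  = sym (AbelianGroup.⁻¹-involutive ℚ.+-0-abelianGroup (toℚ (+ suc n)))

_-↦_ : ∀ {a b x y} → a ↦ x → b ↦ y → a ℤ.- b ↦ x - y
_-↦_ {b = b} p (mk↦ refl) = p +↦ mk↦ (toℚ-neg b)

ι : ∀ z → z ↦ toℚ z
ι z = mk↦ refl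

-- From the integer identity to the quotients f.

ℚ-ring : AlmostCommutativeRing 0ℓ 0ℓ
ℚ-ring = fromCommutativeRing ℚ.+-*-commutativeRing (λ _ → nothing)

-- Each `fᵢ * tᵢ` stands for `sᵢ`. The common factor `t₁²t₂³t₄` absorbs the denominator of `u * u`
-- and is cancelled at the end.
clear-denominators : ∀ {f₀ f₁ f₂ f₃ f₄ t₀ t₁ t₂ t₃ t₄ u : ℚ} → t₁ ≢ 0ℚ → t₂ ≢ 0ℚ → t₄ ≢ 0ℚ →
  u * (t₁ * t₂) ≡ t₀ * t₃ →
  t₃ * (f₃ * t₃) * (t₂ * t₄ * (f₀ * t₀ * (f₀ * t₀)) - f₂ * t₂ * (f₄ * t₄) * (t₀ * t₀))
    ≡ f₁ * t₁ * (f₁ * t₁) * (f₂ * t₂ * (f₂ * t₂) * (f₂ * t₂)) * t₄ + f₄ * t₄ * (t₁ * t₁) * (t₂ * t₂ * t₂) →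
  u * u * (f₃ * (f₀ * f₀ - f₂ * f₄)) ≡ f₁ * f₁ * (f₂ * f₂ * f₂) + f₄
clear-denominators {f₀} {f₁} {f₂} {f₃} {f₄} {t₀} {t₁} {t₂} {t₃} {t₄} {u} t₁≢0 t₂≢0 t₄≢0 u-def formula =
  *-cancelˡ (*-≢0 (*-≢0 (*-≢0 t₁≢0 t₁≢0) (*-≢0 (*-≢0 t₂≢0 t₂≢0) t₂≢0)) t₄≢0) (begin
    t₁ * t₁ * (t₂ * t₂ * t₂) * t₄ * (u * u * (f₃ * (f₀ * f₀ - f₂ * f₄)))
      ≡⟨ RingSolver.solve (f₀ ∷ f₂ ∷ f₃ ∷ f₄ ∷ t₁ ∷ t₂ ∷ t₄ ∷ u ∷ []) ℚ-ring ⟩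
    u * (t₁ * t₂) * (u * (t₁ * t₂)) * (t₂ * t₄ * (f₃ * (f₀ * f₀ - f₂ * f₄)))
      ≡⟨ cong (λ w → w * w * (t₂ * t₄ * (f₃ * (f₀ * f₀ - f₂ * f₄)))) u-def ⟩
    t₀ * t₃ * (t₀ * t₃) * (t₂ * t₄ * (f₃ * (f₀ * f₀ - f₂ * f₄)))
      ≡⟨ RingSolver.solve (f₀ ∷ f₂ ∷ f₃ ∷ f₄ ∷ t₀ ∷ t₂ ∷ t₃ ∷ t₄ ∷ []) ℚ-ring ⟩
    t₃ * (f₃ * t₃) * (t₂ * t₄ * (f₀ * t₀ * (f₀ * t₀)) - f₂ * t₂ * (f₄ * t₄) * (t₀ * t₀))
      ≡⟨ formula ⟩
    f₁ * t₁ * (f₁ * t₁) * (f₂ * t₂ * (f₂ * t₂) * (f₂ * t₂)) * t₄ + f₄ * t₄ * (t₁ * t₁) * (t₂ * t₂ * t₂)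
      ≡⟨ RingSolver.solve (f₁ ∷ f₂ ∷ f₄ ∷ t₁ ∷ t₂ ∷ t₄ ∷ []) ℚ-ring ⟩
    t₁ * t₁ * (t₂ * t₂ * t₂) * t₄ * (f₁ * f₁ * (f₂ * f₂ * f₂) + f₄) ∎)
  where open ≡-Reasoning

squared-formula : ∀ {s₀ s₁ s₂ s₃ s₄ t₀ t₁ t₂ t₃ t₄} → Window s₀ s₁ s₂ s₃ s₄ t₀ t₁ t₂ t₃ t₄ →
  t₀ ≢ 0ℤ → t₁ ≢ 0ℤ → t₂ ≢ 0ℤ → t₃ ≢ 0ℤ → t₄ ≢ 0ℤ →
  let f₀ = toℚ s₀ ÷' toℚ t₀
      f₁ = toℚ s₁ ÷' toℚ t₁
      f₂ = toℚ s₂ ÷' toℚ t₂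
      f₃ = toℚ s₃ ÷' toℚ t₃
      f₄ = toℚ s₄ ÷' toℚ t₄
      u = toℚ (t₀ ℤ.* t₃) ÷' toℚ (t₁ ℤ.* t₂)
  in u * u * (f₃ * (f₀ * f₀ - f₂ * f₄)) ≡ f₁ * f₁ * (f₂ * f₂ * f₂) + f₄
squared-formula {s₀} {s₁} {s₂} {s₃} {s₄} {t₀} {t₁} {t₂} {t₃} {t₄} w t₀≢0 t₁≢0 t₂≢0 t₃≢0 t₄≢0 =
  clear-denominators
    {f₀ = toℚ s₀ ÷' toℚ t₀} {toℚ s₁ ÷' toℚ t₁} {toℚ s₂ ÷' toℚ t₂} {toℚ s₃ ÷' toℚ t₃} {toℚ s₄ ÷' toℚ t₄}
    {toℚ t₀} {t₃ = toℚ t₃} {u = u}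
    (toℚ-≢0 t₁≢0) (toℚ-≢0 t₂≢0) (toℚ-≢0 t₄≢0)
    (begin
      u * (toℚ t₁ * toℚ t₂)  ≡⟨ cong (u *_) (image (ι t₁ *↦ ι t₂)) ⟨
      u * toℚ (t₁ ℤ.* t₂)    ≡⟨ ÷'-*-cancel (toℚ-≢0 (Integers.*-≢0 t₁≢0 t₂≢0)) ⟩
      toℚ (t₀ ℤ.* t₃)        ≡⟨ image (ι t₀ *↦ ι t₃) ⟩
      toℚ t₀ * toℚ t₃        ∎)
    (begin
      -- The term follows the syntax tree of the left side of `window-formula`, with `eᵢ` replacing
      -- `sᵢ` by `fᵢ * tᵢ`.
      _ ≡⟨ image (ι t₃ *↦ e₃ *↦ (ι t₂ *↦ ι t₄ *↦ (e₀ *↦ e₀) -↦ e₂ *↦ e₄ *↦ (ι t₀ *↦ ι t₀))) ⟨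
      toℚ (t₃ ℤ.* s₃ ℤ.* (t₂ ℤ.* t₄ ℤ.* (s₀ ℤ.* s₀) ℤ.- s₂ ℤ.* s₄ ℤ.* (t₀ ℤ.* t₀)))
        ≡⟨ cong toℚ (window-formula w) ⟩
      toℚ (s₁ ℤ.* s₁ ℤ.* (s₂ ℤ.* s₂ ℤ.* s₂) ℤ.* t₄ ℤ.+ s₄ ℤ.* (t₁ ℤ.* t₁) ℤ.* (t₂ ℤ.* t₂ ℤ.* t₂))
        ≡⟨ image (e₁ *↦ e₁ *↦ (e₂ *↦ e₂ *↦ e₂) *↦ ι t₄ +↦ e₄ *↦ (ι t₁ *↦ ι t₁) *↦ (ι t₂ *↦ ι t₂ *↦ ι t₂)) ⟩
      _ ∎)
  where
  open ≡-Reasoning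
  u = toℚ (t₀ ℤ.* t₃) ÷' toℚ (t₁ ℤ.* t₂)

  f*t : ∀ s {t} → t ≢ 0ℤ → s ↦ (toℚ s ÷' toℚ t) * toℚ t
  f*t s t≢0 = mk↦ (sym (÷'-*-cancel (toℚ-≢0 t≢0)))

  e₀ = f*t s₀ t₀≢0
  e₁ = f*t s₁ t₁≢0
  e₂ = f*t s₂ t₂≢0
  e₃ = f*t s₃ t₃≢0
  e₄ = f*t s₄ t₄≢0

theorem4p2 : (n : ℤ) →
    T n ≢ 0ℤ → T (n +ℤ + 1) ≢ 0ℤ → T (n +ℤ + 2) ≢ 0ℤ →
    T (n +ℤ + 3) ≢ 0ℤ → T (n +ℤ + 4) ≢ 0ℤ →
    f (n +ℤ + 3) * (f n * f n - f (n +ℤ + 2) * f (n +ℤ + 4)) ≢ 0ℚ →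
    f (n +ℤ + 1) * (f (n +ℤ + 4) * f (n +ℤ + 4) - f n * f (n +ℤ + 2)) ≢ 0ℚ →
    (v (n +ℤ + 2) * v (n +ℤ + 2)
    ≡ (f (n +ℤ + 1) * f (n +ℤ + 1) * (f (n +ℤ + 2) * f (n +ℤ + 2) * f (n +ℤ + 2)) + f (n +ℤ + 4))
    ÷' (f (n +ℤ + 3) * (f n * f n - f (n +ℤ + 2) * f (n +ℤ + 4))))
    ×
    (v (n +ℤ + 3) * v (n +ℤ + 3)
    ≡ (f (n +ℤ + 2) * f (n +ℤ + 2) * f (n +ℤ + 2) * (f (n +ℤ + 3) * f (n +ℤ + 3)) + f n)
    ÷' (f (n +ℤ + 1) * (f (n +ℤ + 4) * f (n +ℤ + 4) - f n * f (n +ℤ + 2))))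
theorem4p2 n t₀≢0 t₁≢0 t₂≢0 t₃≢0 t₄≢0 d≢0 d′≢0 with windows n t₀≢0 t₁≢0 t₂≢0 t₃≢0 t₄≢0
... | w , w-reversed =
  ÷'-unique d≢0 (begin
    v (n +ℤ + 2) * v (n +ℤ + 2) * (f (n +ℤ + 3) * (f n * f n - f (n +ℤ + 2) * f (n +ℤ + 4)))
      ≡⟨ cong (λ u → u * u * (f (n +ℤ + 3) * (f n * f n - f (n +ℤ + 2) * f (n +ℤ + 4)))) (v-factors n) ⟩
    _ ≡⟨ squared-formula w t₀≢0 t₁≢0 t₂≢0 t₃≢0 t₄≢0 ⟩
    _ ∎) ,
  ÷'-unique d′≢0 (begin
    v (n +ℤ + 3) * v (n +ℤ + 3) * (f (n +ℤ + 1) * (f (n +ℤ + 4) * f (n +ℤ + 4) - f n * f (n +ℤ + 2)))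
      -- The reversed window yields the product in the denominator, and later the two factors in the
      -- numerator, in the opposite order.
      ≡⟨ cong₂ (λ u x → u * u * (f (n +ℤ + 1) * (f (n +ℤ + 4) * f (n +ℤ + 4) - x)))
           (v-factors-reversed n) (ℚ.*-comm (f n) (f (n +ℤ + 2))) ⟩
    _ ≡⟨ squared-formula w-reversed t₄≢0 t₃≢0 t₂≢0 t₁≢0 t₀≢0 ⟩
    f (n +ℤ + 3) * f (n +ℤ + 3) * (f (n +ℤ + 2) * f (n +ℤ + 2) * f (n +ℤ + 2)) + f n
      ≡⟨ cong (_+ f n) (ℚ.*-comm (f (n +ℤ + 3) * f (n +ℤ + 3)) (f (n +ℤ + 2) * f (n +ℤ + 2) * f (n +ℤ + 2))) ⟩
    _ ∎)
  where open ≡-Reasoning
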